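{- The meta-logic $\mathcal{M}_{\mathrm{IPL}}$ is complete for intuitionistic propositional logic (IPL). That is, for all IPL formulae $A_1,\ldots,A_m,B$: for every IPL-proof of $B$ from $A_1,\ldots,A_m$, there is an $\mathcal{M}_{\mathrm{IPL}}$-proof of $[\![B]\!]$ from $[\![A_1]\!],\ldots,[\![A_m]\!]$.
   Context: **The meta-logic $\mathcal{M}$** (a fragment of intuitionistic higher-order logic). Types: basic types, including the type $prop$ of propositions, and function types $\sigma\to\tau$. Terms: those of the simply typed $\lambda$-calculus (constants, variables, abstractions, applications; variables of every type are available); $a(b_1,\ldots,b_k)$ means $(\cdots(a\,b_1)\cdots b_k)$. A (meta-)formula is a term of type $prop$. Logical constants, for every type $\sigma$: $\Rightarrow\;: prop\to(prop\to prop)$, $\bigwedge_\sigma : (\sigma\to prop)\to prop$, $\equiv_\sigma : \sigma\to(\sigma\to prop)$. One writes $\bigwedge x.\phi$ for $\bigwedge_\sigma(\lambda x.\phi)$ with $x:\sigma$; $\Rightarrow$ associates to the right; the scope of a binder extends as far right as possible; $\phi[b/x]$ is capture-avoiding substitution. Inference rules of $\mathcal{M}$ (natural deduction; $\phi,\psi$ are formulae; "assumptions" means the undischarged assumptions on which the premise depends): - $\Rightarrow$-introduction: from a proof of $\psi$ from assumption $\phi$, infer $\phi\Rightarrow\psi$, discharging $\phi$. $\Rightarrow$-elimination: from $\phi\Rightarrow\psi$ and $\phi$ infer $\psi$. - $\bigwedge$-introduction: from $\phi$ infer $\bigwedge x.\phi$, provided $x$ is not free in the assumptions. $\bigwedge$-elimination: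 from $\bigwedge x.\phi$ infer $\phi[b/x]$, for any term $b$ of the type of $x$. - Equality: $a\equiv a$; from $a\equiv b$ infer $b\equiv a$; from $a\equiv b$ and $b\equiv c$ infer $a\equiv c$. - $\lambda$-conversions: $(\lambda x.a)\equiv(\lambda y.a[y/x])$ if $y$ is not free in $a$; $((\lambda x.a)(b))\equiv a[b/x]$; extensionality: from $f(x)\equiv g(x)$ infer $f\equiv g$, if $x$ is not free in the assumptions, $f$, or $g$. - Abstraction: from $a\equiv b$ infer $(\lambda x.a)\equiv(\lambda x.b)$, if $x$ is not free in the assumptions. Combination: from $f\equiv g$ and $a\equiv b$ infer $f(a)\equiv g(b)$. - Logical equivalence: from a proof of $\psi$ from assumption $\phi$ and a proof of $\phi$ from assumption $\psi$, infer $\phi\equiv\psi$, discharging these assumptions; from $\phi\equiv\psi$ and $\phi$ infer $\psi$. **The object-logic IPL.** Formulae are built from propositional variables and $\bot$ by the binary connectives $\&,\vee,\supset$. The natural deduction rules are: - $\&$I: from $A$ and $B$ infer $A\,\&\,B$. $\&$E: from $A\,\&\,B$ infer $A$; from $A\,\&\,B$ infer $B$. - $\vee$I: from $A$ infer $A\vee B$; from $B$ infer $A\vee B$. $\vee$E: from $A\vee B$, a proof of $C$ from assumption $A$, and a proof of $C$ from assumption $B$, infer $C$, discharging these assumptions. - $\supset$I: from a proof of $B$ from assumption $A$ infer $A\supset B$, discharging $A$. $\supset$E: from $A\supset B$ and $A$ infer $B$. - $\bot$E: from $\bot$ infer $A$. An IPL-proof of $B$ from $A_1,\ldots,A_m$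 is a natural deduction with conclusion $B$ all of whose undischarged assumptions are among $A_1,\ldots,A_m$. **The extension $\mathcal{M}_{\mathrm{IPL}}$** is $\mathcal{M}$ together with a basic type $form$, constants $\bot: form$; $\&,\vee,\supset\;: form\to(form\to form)$; $\mathrm{true}: form\to prop$; and the axioms below, where $A,B,C$ are variables of type $form$ and $[\![A]\!]$ abbreviates $\mathrm{true}(A)$: - ($\&$I) $\bigwedge A\,B.\;[\![A]\!]\Rightarrow([\![B]\!]\Rightarrow[\![A\,\&\,B]\!])$ - ($\&$E) $\bigwedge A\,B.\;[\![A\,\&\,B]\!]\Rightarrow[\![A]\!]$ and $\bigwedge A\,B.\;[\![A\,\&\,B]\!]\Rightarrow[\![B]\!]$ - ($\vee$I) $\bigwedge A\,B.\;[\![A]\!]\Rightarrow[\![A\vee B]\!]$ and $\bigwedge A\,B.\;[\![B]\!]\Rightarrow[\![A\vee B]\!]$ - ($\vee$E) $\bigwedge A\,B\,C.\;[\![A\vee B]\!]\Rightarrow([\![A]\!]\Rightarrow[\![C]\!])\Rightarrow([\![B]\!]\Rightarrow[\![C]\!])\Rightarrow[\![C]\!]$ - ($\supset$I) $\bigwedge A\,B.\;([\![A]\!]\Rightarrow[\![B]\!])\Rightarrow[\![A\supset B]\!]$ - ($\supset$E) $\bigwedge A\,B.\;[\![A\supset B]\!]\Rightarrow[\![A]\!]\Rightarrow[\![B]\!]$ - ($\bot$E) $\bigwedge A.\;[\![\bot]\!]\Rightarrow[\![A]\!]$ An $\mathcal{M}_{\mathrm{IPL}}$-proof of $\psi$ from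 $\phi_1,\ldots,\phi_m$ is a deduction of $\psi$ by the rules of $\mathcal{M}$ and these axioms, with undischarged assumptions among $\phi_1,\ldots,\phi_m$. **Translation.** An IPL formula $A$ is read as the evident term of type $form$ (propositional variables being variables of type $form$), and $[\![A]\!]$ is the meta-formula $\mathrm{true}(A)$. -}

module Defs where

open import Data.List using (List; []; _∷_; _++_; [_]; map; filter; concatMap)
open import Data.List.Extrema.Nat using (max)
open import Data.List.Membership.Propositional using (_∈_; _∉_)
open import Data.List.Relation.Binary.Subset.Propositional using (_⊆_)
open import Data.List.Relation.Unary.All using (All)
open import Data.Nat using (ℕ; suc)
import Data.Nat.Properties as ℕ
open import Data.Product using (∃; _,_; proj₁; proj₂)
open import Data.Product.Properties using (≡-dec)
open import Function using (_∘_)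
open import Relation.Binary.Definitions using (DecidableEquality)
open import Relation.Binary.PropositionalEquality using (_≡_; refl; cong)
open import Relation.Nullary using (yes; no; ¬?)
open import Relation.Nullary.Decidable using (map′)

infixr 20 _⟶_

-- Simple types; the basic types are `prop` and `basic s` for `s : S`.
data Type (S : Set) : Set where
  prop  : Type S
  basic : S → Type S
  _⟶_   : Type S → Type S → Type S

module _ {S : Set} (_≟ˢ_ : DecidableEquality S) where

  type-≟ : DecidableEquality (Type S)
  type-≟ prop      prop      = yes refl
  type-≟ prop      (basic _) = no λ ()
  type-≟ prop      (_ ⟶ _)   = no λ ()
  type-≟ (basic _) prop      = no λ ()
  type-≟ (basic s) (basic t) = map′ (cong basic) (λ { refl → refl }) (s ≟ˢ t)
  type-≟ (basic _) (_ ⟶ _)   = no λ ()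
  type-≟ (_ ⟶ _)   prop      = no λ ()
  type-≟ (_ ⟶ _)   (basic _) = no λ ()
  type-≟ (σ ⟶ τ)   (σ′ ⟶ τ′) with type-≟ σ σ′ | type-≟ τ τ′
  ... | yes refl | yes refl = yes refl
  ... | no  σ≢   | _        = no λ { refl → σ≢ refl }
  ... | yes _    | no τ≢    = no λ { refl → τ≢ refl }

-- The meta-logic, over a set `S` of basic types other than `prop` and a
-- family `C` of non-logical constants.
module MetaLogic {S : Set} (_≟ˢ_ : DecidableEquality S) (C : Type S → Set) where

  infixl 30 _·_
  infix  25 _≐_
  infixr 24 _⇒_
  infixr 23 ⋀_∙_
  infix  35 _[_/_]
  infix  10 _#_ _#*_

  record Var (τ : Type S) : Set where
    constructor v
    field name : ℕ

  open Var public

  Variable : Set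
  Variable = ∃ Var

  var-≟ : ∀ {τ} → DecidableEquality (Var τ)
  var-≟ (v m) (v n) = map′ (cong v) (cong name) (m ℕ.≟ n)

  variable-≟ : DecidableEquality Variable
  variable-≟ = ≡-dec (type-≟ _≟ˢ_) var-≟

  data Const : Type S → Set where
    imp   : Const (prop ⟶ prop ⟶ prop)
    all   : ∀ σ → Const ((σ ⟶ prop) ⟶ prop)
    eq    : ∀ σ → Const (σ ⟶ σ ⟶ prop)
    other : ∀ {τ} → C τ → Const τ

  -- Raw terms with named bound variables: not identified up to α-conversion.
  data Term : Type S → Set where
    con : ∀ {τ} → Const τ → Term τ
    var : ∀ {τ} → Var τ → Term τ
    ƛ   : ∀ {σ τ} → Var σ → Term τ → Term (σ ⟶ τ)
    _·_ : ∀ {σ τ} → Term (σ ⟶ τ) → Term σ → Term τ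

  Formula : Set
  Formula = Term prop

  _⇒_ : Formula → Formula → Formula
  φ ⇒ ψ = con imp · φ · ψ

  ⋀_∙_ : ∀ {σ} → Var σ → Formula → Formula
  ⋀ x ∙ φ = con (all _) · ƛ x φ

  _≐_ : ∀ {σ} → Term σ → Term σ → Formula
  a ≐ b = con (eq _) · a · b

  fv : ∀ {τ} → Term τ → List Variable
  fv (con _) = []
  fv (var x) = [ (_ , x) ]
  fv (ƛ x a) = filter (λ y → ¬? (variable-≟ y (_ , x))) (fv a)
  fv (f · a) = fv f ++ fv a

  _#_ : ∀ {σ τ} → Var σ → Term τ → Set
  x # a = (_ , x) ∉ fv a

  _#*_ : ∀ {σ} → Var σ → List Formula → Set
  x #* Γ = All (x #_) Γ

  Subst : Set
  Subst = (x : Variable) → Term (proj₁ x)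

  update : Subst → (x : Variable) → Term (proj₁ x) → Subst
  update s x b y with variable-≟ y x
  ... | yes refl = b
  ... | no  _    = s y

  fresh : List Variable → ℕ
  fresh xs = suc (max 0 (map (name ∘ proj₂) xs))

  -- Simultaneous capture-avoiding substitution. Every binder is renamed, to a
  -- variable not free in any term substituted for a free variable of the
  -- abstraction; this keeps the recursion structural.
  subst : ∀ {τ} → Subst → Term τ → Term τ
  subst s (con c) = con c
  subst s (var x) = s (_ , x)
  subst s (ƛ x a) = ƛ z (subst (update s (_ , x) (var z)) a)
    where z = v (fresh (concatMap (λ y → fv (s y)) (fv (ƛ x a))))
  subst s (f · a) = subst s f · subst s a

  _[_/_] : ∀ {σ τ} → Term τ → Term σ → Var σ → Term τ
  a [ b / x ] = subst (update (λ y → var (proj₂ y)) (_ , x) b) a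

  -- `Γ ⊢ φ`: there is a natural deduction of φ from the axioms `Ax`, all of
  -- whose undischarged assumptions are among Γ. Side conditions concern only
  -- the assumptions on which the premise depends, hence the sublists Δ.
  module Deduction (Ax : Formula → Set) where

    infix 4 _⊢_

    data _⊢_ (Γ : List Formula) : Formula → Set where
      axiom  : ∀ {φ} → Ax φ → Γ ⊢ φ
      assume : ∀ {φ} → φ ∈ Γ → Γ ⊢ φ

      ⇒I : ∀ {φ ψ} → φ ∷ Γ ⊢ ψ → Γ ⊢ φ ⇒ ψ
      ⇒E : ∀ {φ ψ} → Γ ⊢ φ ⇒ ψ → Γ ⊢ φ → Γ ⊢ ψ

      ⋀I : ∀ {σ} {x : Var σ} {φ Δ} → Δ ⊆ Γ → x #* Δ →
           Δ ⊢ φ → Γ ⊢ ⋀ x ∙ φ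
      ⋀E : ∀ {σ} {x : Var σ} {φ} → Γ ⊢ ⋀ x ∙ φ → (b : Term σ) →
           Γ ⊢ φ [ b / x ]

      ≐-refl  : ∀ {σ} {a : Term σ} → Γ ⊢ a ≐ a
      ≐-sym   : ∀ {σ} {a b : Term σ} → Γ ⊢ a ≐ b → Γ ⊢ b ≐ a
      ≐-trans : ∀ {σ} {a b c : Term σ} → Γ ⊢ a ≐ b → Γ ⊢ b ≐ c → Γ ⊢ a ≐ c

      α   : ∀ {σ τ} {x y : Var σ} {a : Term τ} → y # a →
            Γ ⊢ ƛ x a ≐ ƛ y (a [ var y / x ])
      β   : ∀ {σ τ} {x : Var σ} {a : Term τ} {b : Term σ} →
            Γ ⊢ ƛ x a · b ≐ a [ b / x ]
      ext : ∀ {σ τ} {x : Var σ} {f g : Term (σ ⟶ τ)} {Δ} → Δ ⊆ Γ →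
            x #* Δ → x # f → x # g →
            Δ ⊢ f · var x ≐ g · var x → Γ ⊢ f ≐ g

      abs  : ∀ {σ τ} {x : Var σ} {a b : Term τ} {Δ} → Δ ⊆ Γ → x #* Δ →
             Δ ⊢ a ≐ b → Γ ⊢ ƛ x a ≐ ƛ x b
      comb : ∀ {σ τ} {f g : Term (σ ⟶ τ)} {a b : Term σ} →
             Γ ⊢ f ≐ g → Γ ⊢ a ≐ b → Γ ⊢ f · a ≐ g · b

      ≐I : ∀ {φ ψ} → φ ∷ Γ ⊢ ψ → ψ ∷ Γ ⊢ φ → Γ ⊢ φ ≐ ψ
      ≐E : ∀ {φ ψ} → Γ ⊢ φ ≐ ψ → Γ ⊢ φ → Γ ⊢ ψ

module IPL where

  infixr 28 _&_
  infixr 27 _∨_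
  infixr 26 _⊃_
  infix  4 _⊢_

  data Formula : Set where
    pv          : ℕ → Formula
    ⊥           : Formula
    _&_ _∨_ _⊃_ : Formula → Formula → Formula

  -- Natural deductions with all undischarged assumptions among Γ.
  data _⊢_ (Γ : List Formula) : Formula → Set where
    assume : ∀ {A} → A ∈ Γ → Γ ⊢ A
    &I  : ∀ {A B} → Γ ⊢ A → Γ ⊢ B → Γ ⊢ A & B
    &E₁ : ∀ {A B} → Γ ⊢ A & B → Γ ⊢ A
    &E₂ : ∀ {A B} → Γ ⊢ A & B → Γ ⊢ B
    ∨I₁ : ∀ {A B} → Γ ⊢ A → Γ ⊢ A ∨ B
    ∨I₂ : ∀ {A B} → Γ ⊢ B → Γ ⊢ A ∨ B
    ∨E  : ∀ {A B C} → Γ ⊢ A ∨ B → A ∷ Γ ⊢ C → B ∷ Γ ⊢ C → Γ ⊢ C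
    ⊃I  : ∀ {A B} → A ∷ Γ ⊢ B → Γ ⊢ A ⊃ B
    ⊃E  : ∀ {A B} → Γ ⊢ A ⊃ B → Γ ⊢ A → Γ ⊢ B
    ⊥E  : ∀ {A} → Γ ⊢ ⊥ → Γ ⊢ A

-- The extension of the meta-logic whose basic types are `prop` and `K` by the
-- basic type `form` together with the constants and axioms of IPL.
module M-IPL {K : Set} (_≟ᴷ_ : DecidableEquality K) where

  data Sort : Set where
    form : Sort
    old  : K → Sort

  sort-≟ : DecidableEquality Sort
  sort-≟ form    form    = yes refl
  sort-≟ form    (old _) = no λ ()
  sort-≟ (old _) form    = no λ ()
  sort-≟ (old k) (old l) = map′ (cong old) (λ { refl → refl }) (k ≟ᴷ l)

  Form : Type Sort
  Form = basic form

  data IPLConst : Type Sort → Set where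
    bot              : IPLConst Form
    and or implies   : IPLConst (Form ⟶ Form ⟶ Form)
    true             : IPLConst (Form ⟶ prop)

  open MetaLogic sort-≟ IPLConst public

  infixr 28 _&_
  infixr 27 _∨_
  infixr 26 _⊃_

  ⊥ : Term Form
  ⊥ = con (other bot)

  _&_ _∨_ _⊃_ : Term Form → Term Form → Term Form
  a & b = con (other and) · a · b
  a ∨ b = con (other or) · a · b
  a ⊃ b = con (other implies) · a · b

  tr : Term Form → Formula
  tr a = con (other true) · a

  private
    A B C : Var Form
    A = v 0
    B = v 1
    C = v 2

    a b c : Term Form
    a = var A
    b = var B
    c = var C

  data Axiom : Formula → Set where
    &I  : Axiom (⋀ A ∙ ⋀ B ∙ tr a ⇒ tr b ⇒ tr (a & b))
    &E₁ : Axiom (⋀ A ∙ ⋀ B ∙ tr (a & b) ⇒ tr a)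
    &E₂ : Axiom (⋀ A ∙ ⋀ B ∙ tr (a & b) ⇒ tr b)
    ∨I₁ : Axiom (⋀ A ∙ ⋀ B ∙ tr a ⇒ tr (a ∨ b))
    ∨I₂ : Axiom (⋀ A ∙ ⋀ B ∙ tr b ⇒ tr (a ∨ b))
    ∨E  : Axiom (⋀ A ∙ ⋀ B ∙ ⋀ C ∙
                 tr (a ∨ b) ⇒ (tr a ⇒ tr c) ⇒ (tr b ⇒ tr c) ⇒ tr c)
    ⊃I  : Axiom (⋀ A ∙ ⋀ B ∙ (tr a ⇒ tr b) ⇒ tr (a ⊃ b))
    ⊃E  : Axiom (⋀ A ∙ ⋀ B ∙ tr (a ⊃ b) ⇒ tr a ⇒ tr b)
    ⊥E  : Axiom (⋀ A ∙ tr ⊥ ⇒ tr a)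

  open Deduction Axiom public

  ⌜_⌝ : IPL.Formula → Term Form
  ⌜ IPL.pv n ⌝  = var (v n)
  ⌜ IPL.⊥ ⌝     = ⊥
  ⌜ P IPL.& Q ⌝ = ⌜ P ⌝ & ⌜ Q ⌝
  ⌜ P IPL.∨ Q ⌝ = ⌜ P ⌝ ∨ ⌜ Q ⌝
  ⌜ P IPL.⊃ Q ⌝ = ⌜ P ⌝ ⊃ ⌜ Q ⌝

  ⟦_⟧ : IPL.Formula → Formula
  ⟦ P ⟧ = tr ⌜ P ⌝

{-# OPTIONS --safe #-}
-- Each IPL rule is the instance of its axiom at the formulae involved, applied
-- by ⇒-elimination to the translated premises, with ⇒-introduction for the
-- discharged assumptions. The work lies in instantiating nested quantifiers,
-- since a substitution renames every binder below it. As the new name depends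
-- only on the free variables substituted, simultaneous substitutions compose up
-- to syntactic equality, not merely up to α (Stoughton, 1988); so successive
-- ⋀-eliminations amount to one simultaneous substitution in the matrix.
module Submission where

open import Defs
open import Data.List using (List; []; _∷_; _++_; map; filter; concat; concatMap)
open import Data.List.Extrema.Nat using (xs≤max)
open import Data.List.Membership.Propositional using (_∈_; _∉_; lose)
open import Data.List.Membership.Propositional.Properties
  using (∈-map⁺; ∈-++⁺ˡ; ∈-++⁺ʳ; ∈-filter⁺; ∈-concatMap⁺)
open import Data.List.Properties
  using (concatMap-++; map-cong-local; filter-all; filter-none; filter-++; ++-identityʳ)
open import Data.List.Relation.Unary.All as All using (All; []; _∷_)
open import Data.List.Relation.Unary.Any using (here; there)
open import Data.Nat.Properties using (1+n≰n)
open import Data.Product using (_,_; proj₂)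
open import Function using (_∘_)
open import Relation.Binary.Definitions using (DecidableEquality)
open import Relation.Binary.PropositionalEquality
  using (_≡_; _≢_; refl; sym; trans; cong; cong₂; module ≡-Reasoning)
  renaming (subst to transport)
open import Relation.Nullary using (yes; no; ¬?; contradiction)

concatMap-concatMap : ∀ {A B C : Set} (g : B → List C) (f : A → List B) xs →
                      concatMap g (concatMap f xs) ≡ concatMap (concatMap g ∘ f) xs
concatMap-concatMap g f []       = refl
concatMap-concatMap g f (x ∷ xs) =
  trans (concatMap-++ g (f x) (concatMap f xs))
        (cong (concatMap g (f x) ++_) (concatMap-concatMap g f xs))

concatMap-cong-∈ : ∀ {A B : Set} {f g : A → List B} {xs} →
                   (∀ {x} → x ∈ xs → f x ≡ g x) → concatMap f xs ≡ concatMap g xs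
concatMap-cong-∈ eq = cong concat (map-cong-local (All.tabulate eq))

module Substitution {S : Set} (_≟ˢ_ : DecidableEquality S) (C : Type S → Set) where

  open MetaLogic _≟ˢ_ C

  ids : Subst
  ids y = var (proj₂ y)

  delete : Variable → List Variable → List Variable
  delete x = filter (λ y → ¬? (variable-≟ y x))

  update-≡ : ∀ s x b → update s x b x ≡ b
  update-≡ s x b with variable-≟ x x
  ... | yes refl = refl
  ... | no  x≢x  = contradiction refl x≢x

  update-≢ : ∀ s {x y} b → y ≢ x → update s x b y ≡ s y
  update-≢ s {x} {y} b y≢x with variable-≟ y x
  ... | yes refl = contradiction refl y≢x
  ... | no  _    = refl

  -- The passage under a binder `x`: agreement on the free variables of the abstraction becomes
  -- agreement on those of its body.
  update-cong : ∀ {s t x b c} {ys : List Variable} → b ≡ c →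
                (∀ {y} → y ∈ delete x ys → s y ≡ t y) →
                ∀ {y} → y ∈ ys → update s x b y ≡ update t x c y
  update-cong {x = x} b≡c s≡t {y} y∈ys with variable-≟ y x
  ... | yes refl = b≡c
  ... | no  y≢x  = s≡t (∈-filter⁺ _ y∈ys y≢x)

  fresh-∉ : ∀ xs {σ} → (σ , v (fresh xs)) ∉ xs
  fresh-∉ xs z∈xs =
    1+n≰n (All.lookup (xs≤max 0 (map (name ∘ proj₂) xs)) (∈-map⁺ (name ∘ proj₂) z∈xs))

  fresh-# : ∀ (s : Subst) ys {σ y} → y ∈ ys →
            v {σ} (fresh (concatMap (fv ∘ s) ys)) # s y
  fresh-# s ys y∈ys z∈sy =
    fresh-∉ (concatMap (fv ∘ s) ys) (∈-concatMap⁺ (fv ∘ s) (lose y∈ys z∈sy))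

  subst-cong : ∀ {τ} (a : Term τ) {s t : Subst} →
               (∀ {y} → y ∈ fv a → s y ≡ t y) → subst s a ≡ subst t a
  subst-cong (con c) s≡t = refl
  subst-cong (var x) s≡t = s≡t (here refl)
  subst-cong (f · a) s≡t =
    cong₂ _·_ (subst-cong f (s≡t ∘ ∈-++⁺ˡ)) (subst-cong a (s≡t ∘ ∈-++⁺ʳ (fv f)))
  subst-cong (ƛ x a) {s} {t} s≡t =
    -- First the two new binder names are identified, being `fresh` of equal lists; only then can
    -- the bodies be compared.
    trans (cong (λ n → ƛ (v n) (subst (update s (_ , x) (var (v n))) a))
                (cong fresh (concatMap-cong-∈ (cong fv ∘ s≡t))))
          (cong (ƛ _) (subst-cong a (update-cong {s} {t} {_ , x} refl s≡t)))

  delete-∉ : ∀ {x xs} → x ∉ xs → delete x xs ≡ xs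
  delete-∉ x∉xs = filter-all _ (All.tabulate λ { y∈xs refl → x∉xs y∈xs })

  -- Each occurrence of `x` contributes just `z`, which is deleted; at any other variable `z` is
  -- fresh, so the deletion removes nothing.
  delete-concatMap-update :
    ∀ (s : Subst) {σ} (x z : Var σ) ys →
    (∀ {y} → y ∈ delete (_ , x) ys → z # s y) →
    delete (_ , z) (concatMap (fv ∘ update s (_ , x) (var z)) ys)
      ≡ concatMap (fv ∘ s) (delete (_ , x) ys)
  delete-concatMap-update s x z []       z#s = refl
  delete-concatMap-update s x z (y ∷ ys) z#s
    rewrite filter-++ (λ w → ¬? (variable-≟ w (_ , z)))
              (fv (update s (_ , x) (var z) y))
              (concatMap (fv ∘ update s (_ , x) (var z)) ys)
    with variable-≟ y (_ , x)
  ... | yes refl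
    rewrite filter-none (λ w → ¬? (variable-≟ w (_ , z)))
              {(_ , z) ∷ []} ((λ z≢z → z≢z refl) ∷ [])
    = delete-concatMap-update s x z ys z#s
  ... | no _ = cong₂ _++_ (delete-∉ (z#s (here refl)))
                          (delete-concatMap-update s x z ys (z#s ∘ there))

  -- An equality of lists, so that `fresh` yields the same name on both sides by congruence.
  fv-subst : ∀ {τ} (a : Term τ) (s : Subst) → fv (subst s a) ≡ concatMap (fv ∘ s) (fv a)
  fv-subst (con c) s = refl
  fv-subst (var x) s = sym (++-identityʳ _)
  fv-subst (f · a) s = trans (cong₂ _++_ (fv-subst f s) (fv-subst a s))
                             (sym (concatMap-++ (fv ∘ s) (fv f) (fv a)))
  fv-subst (ƛ x a) s =
    trans (cong (delete _) (fv-subst a _))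
          (delete-concatMap-update s x _ (fv a) (fresh-# s (fv (ƛ x a))))

  subst-update : ∀ {τ} (a : Term τ) (s : Subst) {σ} {x : Var σ} {b} →
                 x # a → subst (update s (_ , x) b) a ≡ subst s a
  subst-update a s x#a =
    subst-cong a λ y∈a → update-≢ s _ λ { refl → x#a y∈a }

  -- The intermediate name `z` stands only for `x`, since it is fresh for the other images under
  -- `t`. This freshness is known only for free variables of the abstraction, whence the restriction
  -- to `fv a`.
  subst-update-∘ :
    ∀ {τ} (a : Term τ) (s t : Subst) {σ} (x z : Var σ) b →
    (∀ {y} → y ∈ delete (_ , x) (fv a) → z # t y) →
    ∀ {y} → y ∈ fv a →
    subst (update s (_ , z) b) (update t (_ , x) (var z) y)
      ≡ update (subst s ∘ t) (_ , x) b y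
  subst-update-∘ a s t x z b z#t {y} y∈a with variable-≟ y (_ , x)
  ... | yes refl = update-≡ s (_ , z) b
  ... | no  y≢x  = subst-update (t y) s (z#t (∈-filter⁺ _ y∈a y≢x))

  subst-∘ : ∀ {τ} (a : Term τ) (s t : Subst) → subst s (subst t a) ≡ subst (subst s ∘ t) a
  subst-∘ (con c) s t = refl
  subst-∘ (var x) s t = refl
  subst-∘ (f · a) s t = cong₂ _·_ (subst-∘ f s t) (subst-∘ a s t)
  subst-∘ (ƛ {σ} x a) s t = begin
    ƛ w (subst (update s (_ , z) (var w)) (subst (update t (_ , x) (var z)) a))
      ≡⟨ cong (ƛ w) (subst-∘ a _ _) ⟩
    ƛ w (subst (subst (update s (_ , z) (var w)) ∘ update t (_ , x) (var z)) a)
      ≡⟨ cong (ƛ w) (subst-cong a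
           (subst-update-∘ a s t x z (var w) (fresh-# t (fv (ƛ x a))))) ⟩
    ƛ w (subst (update (subst s ∘ t) (_ , x) (var w)) a)
      -- The name `w` was computed from the free variables of the intermediate term; the composite
      -- substitution computes the same one.
      ≡⟨ cong (λ n → ƛ (v n) (subst (update (subst s ∘ t) (_ , x) (var (v n))) a))
              (cong fresh fv-eq) ⟩
    subst (subst s ∘ t) (ƛ x a) ∎
    where
    open ≡-Reasoning
    z w : Var σ
    z = v (fresh (concatMap (fv ∘ t) (fv (ƛ x a))))
    w = v (fresh (concatMap (fv ∘ s) (fv (subst t (ƛ x a)))))
    fv-eq : concatMap (fv ∘ s) (fv (subst t (ƛ x a)))
              ≡ concatMap (fv ∘ subst s ∘ t) (fv (ƛ x a))
    fv-eq = begin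
      concatMap (fv ∘ s) (fv (subst t (ƛ x a)))
        ≡⟨ cong (concatMap (fv ∘ s)) (fv-subst (ƛ x a) t) ⟩
      concatMap (fv ∘ s) (concatMap (fv ∘ t) (fv (ƛ x a)))
        ≡⟨ concatMap-concatMap (fv ∘ s) (fv ∘ t) (fv (ƛ x a)) ⟩
      concatMap (concatMap (fv ∘ s) ∘ fv ∘ t) (fv (ƛ x a))
        ≡⟨ concatMap-cong-∈ {xs = fv (ƛ x a)} (λ {y} _ → sym (fv-subst (t y) s)) ⟩
      concatMap (fv ∘ subst s ∘ t) (fv (ƛ x a)) ∎

  -- `subst ids` normalises the names of the bound variables, so it does not fix
  -- every term.
  Normal : ∀ {τ} → Term τ → Set
  Normal a = subst ids a ≡ a

  NormalSubst : Subst → Set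
  NormalSubst s = ∀ y → Normal (s y)

  update-normal : ∀ {s x b} → NormalSubst s → Normal b → NormalSubst (update s x b)
  update-normal {x = x} s-normal b-normal y with variable-≟ y x
  ... | yes refl = b-normal
  ... | no  _    = s-normal y

  module _ {Ax : Formula → Set} where

    open Deduction Ax

    -- Elimination instantiates the renamed binder `z` by an update of `ids`, so composing leaves
    -- `subst ids ∘ s` away from `x`. Normality of `s` turns this back into `s`.
    ⋀E-subst : ∀ {Γ σ} {x : Var σ} (φ : Formula) {s : Subst} → NormalSubst s →
               Γ ⊢ subst s (⋀ x ∙ φ) → ∀ b → Γ ⊢ subst (update s (_ , x) b) φ
    ⋀E-subst {Γ} {σ} {x} φ {s} s-normal d b = transport (Γ ⊢_) instance-≡ (⋀E d b)
      where
      open ≡-Reasoning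
      z : Var σ
      z = v (fresh (concatMap (fv ∘ s) (fv (ƛ x φ))))
      instance-≡ : subst (update s (_ , x) (var z)) φ [ b / z ]
                     ≡ subst (update s (_ , x) b) φ
      instance-≡ = begin
        subst (update s (_ , x) (var z)) φ [ b / z ]
          ≡⟨ subst-∘ φ _ _ ⟩
        subst (subst (update ids (_ , z) b) ∘ update s (_ , x) (var z)) φ
          ≡⟨ subst-cong φ
               (subst-update-∘ φ ids s x z b (fresh-# s (fv (ƛ x φ)))) ⟩
        subst (update (subst ids ∘ s) (_ , x) b) φ
          ≡⟨ subst-cong φ (update-cong {_} {s} {_ , x} refl (λ {y} _ → s-normal y)) ⟩
        subst (update s (_ , x) b) φ ∎

    -- The second elimination also acts on `b`, as `subst ids`, whereas `c` enters last. The result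
    -- is simultaneous, so `c` is not put into `b` even if `y` is free there; this occurs, as
    -- propositional variables share names with the bound variables of the axioms.
    ⋀E₂ : ∀ {Γ σ τ} {x : Var σ} {y : Var τ} {φ b} → Normal b → ∀ c →
          Γ ⊢ ⋀ x ∙ ⋀ y ∙ φ →
          Γ ⊢ subst (update (update ids (_ , x) b) (_ , y) c) φ
    ⋀E₂ {φ = φ} {b} b-normal c d =
      ⋀E-subst φ (update-normal (λ _ → refl) b-normal) (⋀E d b) c

    ⋀E₃ : ∀ {Γ ρ σ τ} {x : Var ρ} {y : Var σ} {z : Var τ} {φ b c} →
          Normal b → Normal c → ∀ d →
          Γ ⊢ ⋀ x ∙ ⋀ y ∙ ⋀ z ∙ φ →
          Γ ⊢ subst (update (update (update ids (_ , x) b) (_ , y) c) (_ , z) d) φ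
    ⋀E₃ {z = z} {φ} {_} {c} b-normal c-normal d e =
      ⋀E-subst φ (update-normal (update-normal (λ _ → refl) b-normal) c-normal)
        (⋀E₂ {φ = ⋀ z ∙ φ} b-normal c e) d

module Translation {K : Set} (_≟_ : DecidableEquality K) where

  open M-IPL _≟_
  open Substitution sort-≟ IPLConst

  -- Encoded formulae contain no binder for `subst ids` to rename.
  ⌜⌝-normal : ∀ A → Normal ⌜ A ⌝
  ⌜⌝-normal (IPL.pv n)  = refl
  ⌜⌝-normal IPL.⊥       = refl
  ⌜⌝-normal (A IPL.& B) = cong₂ _&_ (⌜⌝-normal A) (⌜⌝-normal B)
  ⌜⌝-normal (A IPL.∨ B) = cong₂ _∨_ (⌜⌝-normal A) (⌜⌝-normal B)
  ⌜⌝-normal (A IPL.⊃ B) = cong₂ _⊃_ (⌜⌝-normal A) (⌜⌝-normal B)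

  translate : ∀ {Γ B} → Γ IPL.⊢ B → map ⟦_⟧ Γ ⊢ ⟦ B ⟧
  translate (IPL.assume A∈Γ) = assume (∈-map⁺ ⟦_⟧ A∈Γ)
  translate (IPL.&I {A} {B} d e) =
    -- The matrix of the axiom is free of binders and its variables are concrete, so the
    -- substitution computes to the desired instance by definition.
    ⇒E (⇒E (⋀E₂ (⌜⌝-normal A) ⌜ B ⌝ (axiom &I)) (translate d)) (translate e)
  translate (IPL.&E₁ {A} {B} d) =
    ⇒E (⋀E₂ (⌜⌝-normal A) ⌜ B ⌝ (axiom &E₁)) (translate d)
  translate (IPL.&E₂ {A} {B} d) =
    ⇒E (⋀E₂ (⌜⌝-normal A) ⌜ B ⌝ (axiom &E₂)) (translate d)
  translate (IPL.∨I₁ {A} {B} d) =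
    ⇒E (⋀E₂ (⌜⌝-normal A) ⌜ B ⌝ (axiom ∨I₁)) (translate d)
  translate (IPL.∨I₂ {A} {B} d) =
    ⇒E (⋀E₂ (⌜⌝-normal A) ⌜ B ⌝ (axiom ∨I₂)) (translate d)
  translate (IPL.∨E {A} {B} {C} d e f) =
    ⇒E (⇒E (⇒E (⋀E₃ (⌜⌝-normal A) (⌜⌝-normal B) ⌜ C ⌝ (axiom ∨E))
               (translate d))
           -- `map ⟦_⟧` sends the extended context to one headed by the translated assumption, which
           -- is the one discharged.
           (⇒I (translate e)))
       (⇒I (translate f))
  translate (IPL.⊃I {A} {B} d) =
    ⇒E (⋀E₂ (⌜⌝-normal A) ⌜ B ⌝ (axiom ⊃I)) (⇒I (translate d))
  translate (IPL.⊃E {A} {B} d e) =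
    ⇒E (⇒E (⋀E₂ (⌜⌝-normal A) ⌜ B ⌝ (axiom ⊃E)) (translate d)) (translate e)
  translate (IPL.⊥E {A} d) = ⇒E (⋀E (axiom ⊥E) ⌜ A ⌝) (translate d)

theorem3 : {K : Set} (_≟_ : DecidableEquality K) →
    let open M-IPL _≟_ in
    (As : List IPL.Formula) (B : IPL.Formula) →
    As IPL.⊢ B → map ⟦_⟧ As ⊢ ⟦ B ⟧
theorem3 _≟_ As B = Translation.translate _≟_
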